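{- Let $\mathcal G$ be a Petri game with one environment player whose underlying net is concurrency preserving. Then every unfolded global strategy $\sigma$ for the system players in $\mathcal G$ is distributable, i.e. $\sigma$ can be represented as the parallel composition of unfolded local controllers for the environment player and the system players, in the sense that the reachable part of the parallel composition is isomorphic to $\sigma$.
   Context: **Petri nets.** A (place/transition) net $\mathcal N=(\mathcal P,\mathcal T,\mathcal F,\mathit{In})$ consists of disjoint, possibly infinite sets $\mathcal P$ of places and $\mathcal T$ of transitions, a multiset $\mathcal F$ over $(\mathcal P\times\mathcal T)\cup(\mathcal T\times\mathcal P)$ (flow), and an initial marking $\mathit{In}$; a marking is a finite multiset over $\mathcal P$. $\mathit{pre}(y)(x)=\mathcal F(x,y)$ and $\mathit{post}(x)(y)=\mathcal F(x,y)$ define multisets; for each transition $t$, $\mathit{pre}(t)$ and $\mathit{post}(t)$ are finite and non-empty. $t$ is enabled at $M$ if $\mathit{pre}(t)\subseteq M$; firing it gives $M-\mathit{pre}(t)+\mathit{post}(t)$. $\mathcal R(\mathcal N)$ is the set of markings reachable from $\mathit{In}$. $\mathcal N$ is safe if $M(p)\le 1$ for all $M\in\mathcal R(\mathcal N)$, $p\in\mathcal P$. $\mathcal N$ is concurrency preserving if $|\mathit{pre}(t)|=|\mathit{post}(t)|$ for every $t\in\mathcal T$. A homomorphism $h:\mathcal N_1\to\mathcal N_2$ maps places to places and transitions to transitions with $h[\mathit{pre}(t)]=\mathit{pre}(h(t))$ and $h[\mathit{post}(t)]=\mathit{post}(h(t))$ (images of multisets) for all $t\in\mathcal T_1$; it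 is initial if $h[\mathit{In}_1]=\mathit{In}_2$. A weak homomorphism is defined in the same way with the two equalities replaced by multiset inclusions $\subseteq$. An isomorphism is a bijective initial homomorphism; labelled nets are isomorphic if there is an isomorphism preserving labels. $\mathcal N_1$ is an (initial) subnet of $\mathcal N_2$ if $\mathcal P_1\subseteq\mathcal P_2$, $\mathcal T_1\subseteq\mathcal T_2$, $\mathcal F_1\subseteq\mathcal F_2$, $\mathit{In}_1=\mathit{In}_2$. **Unfolding.** Nodes $x,y$ are in conflict if there is a place $p\ne x,y$ from which $x$ and $y$ can be reached along $\mathcal F^+$ leaving $p$ by different arcs. An occurrence net is a net where all $\mathit{pre}(t),\mathit{post}(t)$ are sets, $|\mathit{pre}(p)|\le 1$ for every place $p$, $\mathcal F^{ -1}$ is well-founded, no transition is in conflict with itself, and $\mathit{In}$ is the set of places with empty precondition. Two nodes are concurrent if they are neither related by $\mathcal F^*$ nor in conflict. A branching process of $\mathcal N$ is a pair $(\mathcal N',\lambda)$ of an occurrence net $\mathcal N'$ and a homomorphism $\lambda:\mathcal N'\to\mathcal N$ such that $\mathit{pre}(t_1)=\mathit{pre}(t_2)$ and $\lambda(t_1)=\lambda(t_2)$ imply $t_1=t_2$; it is initial if $\lambda$ is. The unfolding $\beta_U=(\mathcal N^U,\lambda)$ of $\mathcal N$ is the (unique up to isomorphism) initial branching process such that for every $t\in\mathcal T$ and every set $C\subseteq\mathcal P^U$ of pairwise concurrent places with $\lambda[C]=\mathit{pre}(t)$ there is $t^U\in\mathcal T^U$ with $\mathit{pre}(t^U)=C$,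 $\lambda(t^U)=t$. A subprocess of $\beta_U$ is an initial branching process $(\mathcal N_1,\lambda_1)$ with $\mathcal N_1$ an initial subnet of $\mathcal N^U$, $\lambda_1$ the restriction of $\lambda$, and such that the inclusion is a homomorphism. **Petri games.** A Petri game is $\mathcal G=(\mathcal P_S,\mathcal P_E,\mathcal T,\mathcal F,\mathit{In},\mathcal B)$ with underlying net $\mathcal N=(\mathcal P,\mathcal T,\mathcal F,\mathit{In})$, where $\mathcal P=\mathcal P_S\cup\mathcal P_E$ is a disjoint union of system and environment places and $\mathcal B\subseteq\mathcal P$ is the set of bad places. Tokens are players; a token on a place of $\mathcal P_S$ (resp. $\mathcal P_E$) is a system (resp. environment) player. One environment player means: every reachable marking has exactly one token on $\mathcal P_E$. **Strategies.** An unfolded (global) strategy for the system players is a subprocess $\sigma=(\mathcal N^\sigma,\lambda^\sigma)$ of $\beta_U$ such that for every $p\in\mathcal P^\sigma$: (S1) if $\lambda(p)\in\mathcal P_S$, then for every $M\in\mathcal R(\mathcal N^\sigma)$ with $p\in M$ there is at most one $t\in\mathcal T^\sigma$ with $p\in\mathit{pre}(t)\subseteq M$; (S2) if $\lambda(p)\in\mathcal P_E$, then every $t\in\mathcal T^U$ with $\mathit{pre}(t)=\{p\}$ belongs to $\mathcal N^\sigma$ (with the arc $(p,t)$). **Local controllers and distribution.** A local controller is a pair $\mathcal C=(\mathcal N^C,h^C)$ of a safe net $\mathcal N^C$ with $|\mathit{In}^C|=1$ and $|\mathit{pre}^C(t)|=|\mathit{post}^C(t)|=1$ for all $t\in\mathcal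 T^C$, and a weak homomorphism $h^C$ from $\mathcal N^C$ to the underlying net $\mathcal N$ of the game. It is a controller for the environment (resp. for a system player) if $h^C$ maps all places to $\mathcal P_E$ (resp. $\mathcal P_S$). If $(\mathcal N^{CU},\lambda^C)$ is the unfolding of $\mathcal N^C$, then $(\mathcal N^{CU},h^C\circ\lambda^C)$ is an unfolded local controller. The parallel composition $\mathcal N_1\,\|\,\mathcal N_2$ of nets with $\mathcal P_1\cap\mathcal P_2=\emptyset$ is the componentwise union $(\mathcal P_1\cup\mathcal P_2,\mathcal T_1\cup\mathcal T_2,\mathcal F_1\cup\mathcal F_2,\mathit{In}_1\cup\mathit{In}_2)$, so the nets synchronize on common transitions; for controllers, the label maps are assumed to agree on common transitions and are united. The reachable part of a net is its restriction to the places and transitions reachable from the initial marking (places marked at some reachable marking, transitions enabled at some reachable marking). -}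

module Defs where

open import Level using (Level) renaming (suc to lsuc)
open import Data.Empty using (⊥-elim)
open import Data.Fin using (Fin; zero; suc)
open import Data.List using (List; []; _∷_; _++_; map; length; filter; concatMap; allFin)
open import Data.List.Membership.Propositional using (_∈_; mapWith∈)
open import Data.List.Membership.Propositional.Properties
  using (∈-map⁺; ∈-concatMap⁺; ∈-++⁺ˡ; ∈-allFin)
open import Data.List.Relation.Unary.Any as Any using (Any; here)
open import Data.List.Relation.Unary.AllPairs using (AllPairs)
open import Data.List.Relation.Unary.Unique.Propositional using (Unique)
open import Data.List.Relation.Binary.Permutation.Propositional using (_↭_; ↭-refl)
open import Data.List.Relation.Binary.Permutation.Propositional.Properties using (∈-resp-↭)
open import Data.Irrelevant using ([_])
open import Data.Nat using (ℕ; suc)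
open import Data.Product using (Σ; ∃-syntax; _×_; _,_)
open import Data.Refinement using (Refinement; _,_; value)
open import Data.Sum using (_⊎_; inj₁; inj₂)
open import Function using (_∘_)
open import Function.Bundles using (_⇔_)
open import Function.Definitions using (Injective; Bijective)
open import Induction.WellFounded using (WellFounded)
open import Relation.Binary.Construct.Closure.ReflexiveTransitive using (Star)
open import Relation.Binary.PropositionalEquality using (_≡_; _≢_; refl)
open import Relation.Nullary using (¬_; Dec; yes; no)
open import Relation.Unary using (Pred; Decidable)

private
  variable
    ℓ : Level

-- A finite multiset is a list taken up to permutation _↭_: its cardinality is
-- the length, the image h[M] is map h M, and being a set is Unique.

infix 4 _⊑_

_⊑_ : {A : Set ℓ} → List A → List A → Set ℓ
xs ⊑ ys = ∃[ zs ] (xs ++ zs ↭ ys)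

-- Since pre(t) and post(t) are finite, the flow multiset F amounts to these
-- two families: F(p,t) is the multiplicity of p in pre t, and F(t,p) its
-- multiplicity in post t.

record Net (ℓ : Level) : Set (lsuc ℓ) where
  field
    Place Trans    : Set ℓ
    pre post       : Trans → List Place
    pre-nonempty   : ∀ t → pre t ≢ []
    post-nonempty  : ∀ t → post t ≢ []
    In             : List Place

  Marking : Set ℓ
  Marking = List Place

  infix 4 _[_⟩_ _⟶_ _⟶*_

  -- The rest R of the marking M is M - pre(t), so M' = M - pre(t) + post(t).
  _[_⟩_ : Marking → Trans → Marking → Set ℓ
  M [ t ⟩ M′ = ∃[ R ] (pre t ++ R ↭ M × M′ ↭ post t ++ R)

  data Reachable : Marking → Set ℓ where
    initially : ∀ {M} → M ↭ In → Reachable M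
    fire      : ∀ {M t M′} → Reachable M → M [ t ⟩ M′ → Reachable M′

  Safe : Set ℓ
  Safe = ∀ {M} → Reachable M → Unique M

  ConcurrencyPreserving : Set ℓ
  ConcurrencyPreserving = ∀ t → length (pre t) ≡ length (post t)

  Node : Set ℓ
  Node = Place ⊎ Trans

  data _⟶_ : Node → Node → Set ℓ where
    into  : ∀ {p t} → p ∈ pre t → inj₁ p ⟶ inj₂ t
    outof : ∀ {p t} → p ∈ post t → inj₂ t ⟶ inj₁ p

  _⟶*_ : Node → Node → Set ℓ
  _⟶*_ = Star _⟶_

  InConflict : Node → Node → Set ℓ
  InConflict x y =
    ∃[ p ] (inj₁ p ≢ x × inj₁ p ≢ y ×
      ∃[ t ] ∃[ u ] (p ∈ pre t × p ∈ pre u × t ≢ u × inj₂ t ⟶* x × inj₂ u ⟶* y))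

  Concurrent : Node → Node → Set ℓ
  Concurrent x y = ¬ (x ⟶* y) × ¬ (y ⟶* x) × ¬ InConflict x y

  record IsOccurrenceNet : Set ℓ where
    field
      pre-set          : ∀ t → Unique (pre t)
      post-set         : ∀ t → Unique (post t)
      one-producer     : ∀ {p t u} → p ∈ post t → p ∈ post u → t ≡ u
      -- WellFounded R excludes chains descending along R, i.e. backward
      -- chains of arcs: this is what "F⁻¹ is well-founded" says.
      wellFounded      : WellFounded _⟶_
      no-self-conflict : ∀ t → ¬ InConflict (inj₂ t) (inj₂ t)
      In-set           : Unique In
      In-minimal       : ∀ p → p ∈ In ⇔ (∀ t → ¬ p ∈ post t)

open Net using (Place; Trans)

record NodeMap (N₁ N₂ : Net ℓ) : Set ℓ where
  field
    place  : Place N₁ → Place N₂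
    transn : Trans N₁ → Trans N₂

open NodeMap

infixr 9 _⊚_

_⊚_ : {N₁ N₂ N₃ : Net ℓ} → NodeMap N₂ N₃ → NodeMap N₁ N₂ → NodeMap N₁ N₃
g ⊚ f = record { place = place g ∘ place f ; transn = transn g ∘ transn f }

module _ {N₁ N₂ : Net ℓ} (h : NodeMap N₁ N₂) where
  private
    module N₁ = Net N₁
    module N₂ = Net N₂

  IsHomomorphism : Set ℓ
  IsHomomorphism = ∀ t →
    (map (place h) (N₁.pre t) ↭ N₂.pre (transn h t)) ×
    (map (place h) (N₁.post t) ↭ N₂.post (transn h t))

  IsWeakHomomorphism : Set ℓ
  IsWeakHomomorphism = ∀ t →
    (map (place h) (N₁.pre t) ⊑ N₂.pre (transn h t)) ×
    (map (place h) (N₁.post t) ⊑ N₂.post (transn h t))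

  IsInitial : Set ℓ
  IsInitial = map (place h) N₁.In ↭ N₂.In

  -- P₁ ⊆ P₂ and T₁ ⊆ T₂ are rendered by injections.
  record IsSubnetInclusion : Set ℓ where
    field
      place-injective  : Injective _≡_ _≡_ (place h)
      transn-injective : Injective _≡_ _≡_ (transn h)
      flow-⊆           : IsWeakHomomorphism
      In-≡             : IsInitial

  record IsIsomorphism : Set ℓ where
    field
      homomorphism     : IsHomomorphism
      initial          : IsInitial
      place-bijective  : Bijective _≡_ _≡_ (place h)
      transn-bijective : Bijective _≡_ _≡_ (transn h)

record LabelledNet (N : Net ℓ) : Set (lsuc ℓ) where
  field
    net   : Net ℓ
    label : NodeMap net N

infix 4 _≅_

record _≅_ {N : Net ℓ} (L₁ L₂ : LabelledNet N) : Set ℓ where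
  private
    module L₁ = LabelledNet L₁
    module L₂ = LabelledNet L₂
  field
    to              : NodeMap L₁.net L₂.net
    isIsomorphism   : IsIsomorphism to
    place-labelled  : ∀ p → place L₂.label (place to p) ≡ place L₁.label p
    transn-labelled : ∀ t → transn L₂.label (transn to t) ≡ transn L₁.label t

record BranchingProcess (N : Net ℓ) : Set (lsuc ℓ) where
  field
    net            : Net ℓ
    label          : NodeMap net N
    occurrenceNet  : Net.IsOccurrenceNet net
    homomorphism   : IsHomomorphism label
    no-duplicates  : ∀ {t u} → Net.pre net t ↭ Net.pre net u →
                     transn label t ≡ transn label u → t ≡ u

  labelledNet : LabelledNet N
  labelledNet = record { net = net ; label = label }

-- A set C with λ[C] = pre(t) is finite, hence a duplicate-free list.
record IsUnfolding {N : Net ℓ} (β : BranchingProcess N) : Set ℓ where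
  open BranchingProcess β
  open Net net hiding (Place; Trans)
  field
    initial  : IsInitial label
    complete : ∀ t (C : List (Place net)) → Unique C →
               AllPairs (λ p q → Concurrent (inj₁ p) (inj₁ q)) C →
               map (place label) C ↭ Net.pre N t →
               ∃[ u ] (pre u ↭ C × transn label u ≡ t)

record Subprocess {N : Net ℓ} (β : BranchingProcess N) : Set (lsuc ℓ) where
  private
    module β = BranchingProcess β
  field
    process                : BranchingProcess N
  open BranchingProcess process public
  field
    initial                : IsInitial label
    inclusion              : NodeMap net β.net
    isSubnet               : IsSubnetInclusion inclusion
    inclusion-homomorphism : IsHomomorphism inclusion
    place-restricts        : ∀ p → place label p ≡ place β.label (place inclusion p)
    transn-restricts       : ∀ t → transn label t ≡ transn β.label (transn inclusion t)

data Owner : Set where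
  system environment : Owner

record PetriGame (ℓ : Level) : Set (lsuc ℓ) where
  field
    net   : Net ℓ
    owner : Place net → Owner
    Bad   : Pred (Place net) ℓ

  OnEnvironment : Pred (Place net) _
  OnEnvironment p = owner p ≡ environment

  onEnvironment? : Decidable OnEnvironment
  onEnvironment? p with owner p
  ... | system      = no λ ()
  ... | environment = yes refl

  OneEnvironmentPlayer : Set ℓ
  OneEnvironmentPlayer = ∀ {M} → Net.Reachable net M →
    length (filter onEnvironment? M) ≡ 1

record Strategy (G : PetriGame ℓ) (β : BranchingProcess (PetriGame.net G)) : Set (lsuc ℓ) where
  open PetriGame G using (owner)
  private
    module U = Net (BranchingProcess.net β)
  field
    subprocess : Subprocess β
  open Subprocess subprocess public
  open Net net
  field
    S1 : ∀ p → owner (place label p) ≡ system →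
         ∀ {M} → Reachable M → p ∈ M →
         ∀ {t u} → p ∈ pre t → pre t ⊑ M → p ∈ pre u → pre u ⊑ M → t ≡ u
    S2 : ∀ p → owner (place label p) ≡ environment →
         ∀ t → U.pre t ↭ place inclusion p ∷ [] →
         ∃[ u ] (transn inclusion u ≡ t × p ∈ pre u)

record LocalController (N : Net ℓ) : Set (lsuc ℓ) where
  field
    net             : Net ℓ
    map-to          : NodeMap net N
  open Net net
  field
    safe            : Safe
    single-token    : length In ≡ 1
    single-pre      : ∀ t → length (pre t) ≡ 1
    single-post     : ∀ t → length (post t) ≡ 1
    weak-homomorphism : IsWeakHomomorphism map-to

ControllerFor : (G : PetriGame ℓ) → Owner → LocalController (PetriGame.net G) → Set ℓ
ControllerFor G o C = ∀ p → PetriGame.owner G (place (LocalController.map-to C) p) ≡ o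

record UnfoldedLocalController (G : PetriGame ℓ) (o : Owner) : Set (lsuc ℓ) where
  field
    controller  : LocalController (PetriGame.net G)
    for-owner   : ControllerFor G o controller
  open LocalController controller using (net; map-to)
  field
    process     : BranchingProcess net
    isUnfolding : IsUnfolding process

  labelledNet : LabelledNet (PetriGame.net G)
  labelledNet = record
    { net   = BranchingProcess.net process
    ; label = map-to ⊚ BranchingProcess.label process
    }

-- The union T of the transition sets of a family of labelled nets, presented
-- by jointly surjective injections into T: transitions of different nets are
-- common (the same transition) exactly if they have the same name. The last
-- field says that the label maps agree on common transitions.

record TransitionUnion {N : Net ℓ} {k : ℕ} (L : Fin k → LabelledNet N) : Set (lsuc ℓ) where
  private
    module L i = LabelledNet (L i)
  field
    T              : Set ℓ
    name           : ∀ i → Trans (L.net i) → T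
    name-injective : ∀ i → Injective _≡_ _≡_ (name i)
    name?          : ∀ i a → Dec (∃[ t ] name i t ≡ a)
    covered        : ∀ a → ∃[ i ] ∃[ t ] name i t ≡ a
    labels-agree   : ∀ i j {t u} → name i t ≡ name j u →
                     transn (L.label i) t ≡ transn (L.label j) u

-- Places of different components are tagged, hence disjoint. The places
-- before (after) a transition a are those before (after) a in each of the
-- components that contain a.

module Parallel {N : Net ℓ} {k : ℕ} (L : Fin k → LabelledNet N) (∪T : TransitionUnion L) where
  private
    module L i = LabelledNet (L i)
  open TransitionUnion ∪T

  Places : Set ℓ
  Places = Σ (Fin k) λ i → Place (L.net i)

  contribution : (∀ i → Trans (L.net i) → List (Place (L.net i))) →
                 ∀ a i → Dec (∃[ t ] name i t ≡ a) → List Places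
  contribution f a i (yes (t , _)) = map (i ,_) (f i t)
  contribution f a i (no _)        = []

  unite : (∀ i → Trans (L.net i) → List (Place (L.net i))) → T → List Places
  unite f a = concatMap (λ i → contribution f a i (name? i a)) (allFin k)

  private
    ≢[]⇒∈ : {A : Set ℓ} {xs : List A} → xs ≢ [] → ∃[ x ] x ∈ xs
    ≢[]⇒∈ {xs = []}     ne = ⊥-elim (ne refl)
    ≢[]⇒∈ {xs = x ∷ xs} _  = x , here refl

    ∈⇒≢[] : {A : Set ℓ} {x : A} {xs : List A} → x ∈ xs → xs ≢ []
    ∈⇒≢[] () refl

    contribution-nonempty : ∀ f → (∀ i t → f i t ≢ []) → ∀ a i d →
      ∃[ t ] name i t ≡ a → ∃[ x ] x ∈ contribution f a i d
    contribution-nonempty f ne a i (yes (t , _)) _ with ≢[]⇒∈ (ne i t)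
    ... | x , x∈ = (i , x) , ∈-map⁺ (i ,_) x∈
    contribution-nonempty f ne a i (no ∄t) ∃t = ⊥-elim (∄t ∃t)

  unite-nonempty : ∀ f → (∀ i t → f i t ≢ []) → ∀ a → unite f a ≢ []
  unite-nonempty f ne a with covered a
  ... | i , ∃t with contribution-nonempty f ne a i (name? i a) ∃t
  ... | x , x∈ = ∈⇒≢[] (∈-concatMap⁺ _ (lift (∈-allFin i)))
    where
    lift : ∀ {is} → i ∈ is → Any (λ j → x ∈ contribution f a j (name? j a)) is
    lift = Any.map λ { refl → x∈ }

  net : Net ℓ
  net = record
    { Place         = Places
    ; Trans         = T
    ; pre           = unite (λ i → Net.pre (L.net i))
    ; post          = unite (λ i → Net.post (L.net i))
    ; pre-nonempty  = unite-nonempty _ (λ i → Net.pre-nonempty (L.net i))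
    ; post-nonempty = unite-nonempty _ (λ i → Net.post-nonempty (L.net i))
    ; In            = concatMap (λ i → map (i ,_) (Net.In (L.net i))) (allFin k)
    }

  -- By labels-agree the choice of component made by covered does not matter.
  composition : LabelledNet N
  composition = record
    { net   = net
    ; label = record
      { place  = λ (i , p) → place (L.label i) p
      ; transn = λ a → let i , t , _ = covered a in transn (L.label i) t
      }
    }

-- Membership proofs are irrelevant, so that these are genuine subsets.

module ReachablePart (N : Net ℓ) where
  open Net N hiding (Place; Trans)

  Marked : Pred (Place N) ℓ
  Marked p = ∃[ M ] (Reachable M × p ∈ M)

  EnabledSomewhere : Pred (Trans N) ℓ
  EnabledSomewhere t = ∃[ M ] (Reachable M × pre t ⊑ M)

  restrict : (M : Marking) → .(∀ {p} → p ∈ M → Marked p) → List (Refinement (Place N) Marked)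
  restrict M marked = mapWith∈ M (λ {p} p∈M → p , [ marked p∈M ])

  restrict-nonempty : ∀ M .(marked : ∀ {p} → p ∈ M → Marked p) → M ≢ [] → restrict M marked ≢ []
  restrict-nonempty []      _ ne _ = ne refl
  restrict-nonempty (_ ∷ _) _ _ ()

  pre-marked : ∀ {t} → EnabledSomewhere t → ∀ {p} → p ∈ pre t → Marked p
  pre-marked (M , r , _ , pre⊑M) p∈ = M , r , ∈-resp-↭ pre⊑M (∈-++⁺ˡ p∈)

  post-marked : ∀ {t} → EnabledSomewhere t → ∀ {p} → p ∈ post t → Marked p
  post-marked (M , r , R , pre⊑M) p∈ =
    _ , fire r (R , pre⊑M , ↭-refl) , ∈-++⁺ˡ p∈

  reachableNet : Net ℓ
  reachableNet = record
    { Place         = Refinement (Place N) Marked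
    ; Trans         = Refinement (Trans N) EnabledSomewhere
    ; pre           = λ { (t , [ e ]) → restrict (pre t) (pre-marked e) }
    ; post          = λ { (t , [ e ]) → restrict (post t) (post-marked e) }
    ; pre-nonempty  = λ { (t , [ e ]) → restrict-nonempty (pre t) (pre-marked e) (pre-nonempty t) }
    ; post-nonempty = λ { (t , [ e ]) → restrict-nonempty (post t) (post-marked e) (post-nonempty t) }
    ; In            = restrict In (λ p∈ → In , initially ↭-refl , p∈)
    }

  include : NodeMap reachableNet N
  include = record { place = value ; transn = value }

reachablePart : {N : Net ℓ} → LabelledNet N → LabelledNet N
reachablePart L = record
  { net   = ReachablePart.reachableNet net
  ; label = label ⊚ ReachablePart.include net
  }
  where open LabelledNet L

components : {G : PetriGame ℓ} {k : ℕ} → UnfoldedLocalController G environment →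
             (Fin k → UnfoldedLocalController G system) →
             Fin (suc k) → LabelledNet (PetriGame.net G)
components E S zero    = UnfoldedLocalController.labelledNet E
components E S (suc i) = UnfoldedLocalController.labelledNet (S i)

record Distributable (G : PetriGame ℓ) (L : LabelledNet (PetriGame.net G)) : Set (lsuc ℓ) where
  field
    k               : ℕ
    envController   : UnfoldedLocalController G environment
    sysControllers  : Fin k → UnfoldedLocalController G system
    transitionUnion : TransitionUnion (components envController sysControllers)
    represents      : reachablePart (Parallel.composition _ transitionUnion) ≅ L

{-# OPTIONS --safe #-}

-- Since |pre t| = |post t| and exactly one token is on an environment place,
-- the places before and after a transition can be matched so that owners are
-- preserved. Following the matching backwards, every place of σ descends from
-- a unique initial place, and this colours the places of σ with one colour
-- per player. The colours of a reachable marking are always a permutation of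
-- all players, so that restricting σ to one colour gives a net with a single
-- token. This net is an occurrence net, hence its own unfolding. Every node of
-- an occurrence net is reachable, so putting the colours together again gives
-- back all of σ.

module Submission where

open import Defs
open import Axiom.ExcludedMiddle using (ExcludedMiddle)

open import Level using (Level)
open import Data.Empty using (⊥-elim)
open import Data.Fin using (Fin; zero; suc; _≟_)
open import Data.Irrelevant using ([_])
open import Data.List
  using (List; []; _∷_; _++_; map; length; filter; concatMap; allFin; lookup; tabulate; replicate)
open import Data.List.Membership.Propositional using (_∈_; _∉_; find)
import Data.List.Membership.DecPropositional as DecMembership
open import Data.List.Membership.Propositional.Properties
  using (∈-map⁺; ∈-map⁻; ∈-++⁺ˡ; ∈-++⁺ʳ; ∈-++⁻; ∈-∃++; ∈-filter⁺; ∈-filter⁻; ∈-allFin;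
         ∈-concatMap⁺; ∈-concatMap⁻; ∈-lookup; ∈-tabulate⁺; ∈-tabulate⁻)
open import Data.List.Properties
  using (map-++; map-∘; map-cong; map-cong-local; map-id; map-tabulate; tabulate-lookup; tabulate-cong;
         length-map; length-++; filter-reject; filter-none;
         ∷-injectiveˡ; ∷-injectiveʳ; filter-++; length-filter; map-concatMap; concatMap-cong; ++-assoc)
open import Data.List.Relation.Binary.Permutation.Propositional
  using (_↭_; ↭-refl; ↭-sym; ↭-trans; ↭-reflexive; prep; ↭⇒↭ₛ; module PermutationReasoning)
open import Data.List.Relation.Binary.Permutation.Propositional.Properties
  using (∈-resp-↭; map⁺; ↭-map-inv; ↭-length; shift; shifts; ++⁺ˡ; ++⁺ʳ;
         filter-↭)
import Data.List.Relation.Binary.Permutation.Setoid.Properties as ↭ₛ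
open import Data.List.Relation.Unary.All as All using (All; []; _∷_)
import Data.List.Relation.Unary.All.Properties as All
open import Data.List.Relation.Unary.AllPairs using ([]; _∷_)
open import Data.List.Relation.Unary.Any as Any using (here; there)
open import Data.List.Relation.Unary.Unique.Propositional using (Unique)
import Data.List.Relation.Unary.Unique.Propositional.Properties as Unique
open import Data.Nat using (ℕ; suc; _+_; _∸_)
open import Data.Nat.Properties using (+-∸-assoc; +-cancelʳ-≡)
open import Data.Product using (Σ; ∃-syntax; _×_; _,_; proj₁; proj₂)
open import Data.Refinement using (Refinement; _,_; value)
open import Data.Sum using (inj₁; inj₂; [_,_]′)
import Data.Sum as Sum
open import Function using (_∘_; id)
open import Function.Bundles using (mk⇔; module Equivalence)
open import Induction.WellFounded using (Acc; acc; module Subrelation)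
open import Relation.Binary.Construct.Closure.ReflexiveTransitive using (ε; _◅_; gmap)
import Relation.Binary.Construct.On as On
open import Relation.Binary.PropositionalEquality
open import Relation.Nullary using (¬_; Dec; yes; no)
open import Relation.Nullary.Decidable using (recompute)
open import Relation.Unary using (Pred; Decidable)
open import Relation.Unary.Properties using (∁?)

open Net using (Place; Trans; pre; post; In)
open NodeMap

private
  variable
    ℓ p : Level
    A B : Set ℓ

-- Lists as multisets: filtering, inclusion, matching

module _ {P : Pred A p} (P? : Decidable P) where

  filter-∁-↭ : ∀ xs → xs ↭ filter P? xs ++ filter (∁? P?) xs
  filter-∁-↭ [] = ↭-refl
  filter-∁-↭ (x ∷ xs) with P? x
  ... | yes _ = prep x (filter-∁-↭ xs)
  ... | no _  = ↭-trans (prep x (filter-∁-↭ xs)) (↭-sym (shift x (filter P? xs) _))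

  filter-map : (f : B → A) → ∀ xs → filter P? (map f xs) ≡ map f (filter (P? ∘ f) xs)
  filter-map f [] = refl
  filter-map f (x ∷ xs) with P? (f x)
  ... | yes _ = cong (f x ∷_) (filter-map f xs)
  ... | no _  = filter-map f xs

  extract-unique : ∀ xs → length (filter P? xs) ≡ 1 →
                   ∃[ x ] ∃[ ys ] (xs ↭ x ∷ ys × P x × All (¬_ ∘ P) ys)
  extract-unique xs eq with filter P? xs | filter-∁-↭ xs | All.all-filter P? xs
  ... | x ∷ [] | xs↭ | px ∷ [] = x , _ , xs↭ , px , All.all-filter (∁? P?) xs

↭-unique : {xs ys : List A} → xs ↭ ys → Unique xs → Unique ys
↭-unique xs↭ys = ↭ₛ.Unique-resp-↭ (setoid _) (↭⇒↭ₛ xs↭ys)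

unique-++ˡ : (xs : List A) {ys : List A} → Unique (xs ++ ys) → Unique xs
unique-++ˡ []       _        = []
unique-++ˡ (x ∷ xs) (x∉ ∷ u) = All.++⁻ˡ xs x∉ ∷ unique-++ˡ xs u

⊑-unique : {xs ys : List A} → xs ⊑ ys → Unique ys → Unique xs
⊑-unique (_ , eq) u = unique-++ˡ _ (↭-unique (↭-sym eq) u)

singleton-unique : {xs : List A} → length xs ≡ 1 → Unique xs
singleton-unique {xs = _ ∷ []} _ = [] ∷ []

singleton-nonempty : {xs : List A} → length xs ≡ 1 → xs ≢ []
singleton-nonempty () refl

nonempty-∈ : {xs : List A} → xs ≢ [] → ∃[ x ] x ∈ xs
nonempty-∈ {xs = []}    ne = ⊥-elim (ne refl)
nonempty-∈ {xs = x ∷ _} _  = x , here refl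

⊑-map : (f : A → B) {xs ys : List A} → xs ⊑ ys → map f xs ⊑ map f ys
⊑-map f {xs} (zs , eq) = map f zs , ↭-trans (↭-reflexive (sym (map-++ f xs zs))) (map⁺ f eq)

⊑-respˡ : {xs ys zs : List A} → xs ↭ ys → xs ⊑ zs → ys ⊑ zs
⊑-respˡ xs↭ys (ws , eq) = ws , ↭-trans (++⁺ʳ ws (↭-sym xs↭ys)) eq

⊑-respʳ : {xs ys zs : List A} → ys ↭ zs → xs ⊑ ys → xs ⊑ zs
⊑-respʳ ys↭zs (ws , eq) = ws , ↭-trans eq ys↭zs

-- Lets enabledness be checked place by place: a duplicate-free preset fits into a marking once each
-- of its places is marked. Each `x` is cut out of `ys` before the recursion, and uniqueness keeps
-- the remaining members of `xs` clear of the cut.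
unique-⊆⇒⊑ : {xs ys : List A} → Unique xs → (∀ {x} → x ∈ xs → x ∈ ys) → xs ⊑ ys
unique-⊆⇒⊑ {ys = ys} [] _ = ys , ↭-refl
unique-⊆⇒⊑ {xs = x ∷ xs} (x∉ ∷ u) xs⊆ys with ∈-∃++ (xs⊆ys (here refl))
... | us , vs , refl with unique-⊆⇒⊑ u (λ y∈ → remove y∈ (∈-resp-↭ (shift x us vs) (xs⊆ys (there y∈))))
  where
  remove : ∀ {y} → y ∈ xs → y ∈ x ∷ us ++ vs → y ∈ us ++ vs
  remove y∈ (here refl) = ⊥-elim (All.lookup x∉ y∈ refl)
  remove _  (there y∈)  = y∈
... | zs , eq = zs , ↭-trans (prep x eq) (↭-sym (shift x us vs))

lookup-injective : {xs : List A} → Unique xs → ∀ {i j} → lookup xs i ≡ lookup xs j → i ≡ j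
lookup-injective (_  ∷ _) {zero}  {zero}  _  = refl
lookup-injective (x∉ ∷ _) {zero}  {suc j} eq = ⊥-elim (All.lookup x∉ (∈-lookup j) eq)
lookup-injective (x∉ ∷ _) {suc i} {zero}  eq = ⊥-elim (All.lookup x∉ (∈-lookup i) (sym eq))
lookup-injective (_  ∷ u) {suc i} {suc j} eq = cong suc (lookup-injective u eq)

pair-up : (f : A → B) (xs ys : List A) → map f xs ≡ map f ys →
          ∃[ ls ] (map proj₁ ls ≡ xs × map proj₂ ls ≡ ys × All (λ (x , y) → f x ≡ f y) ls)
pair-up f []       []       _  = [] , refl , refl , []
pair-up f (x ∷ xs) (y ∷ ys) eq with pair-up f xs ys (∷-injectiveʳ eq)
... | ls , refl , refl , fs = (x , y) ∷ ls , refl , refl , ∷-injectiveˡ eq ∷ fs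

-- A permutation of the images lifts to a reordering of `ys` whose images agree with those of `xs`
-- in order, so the two lists can be paired entry by entry.
match : (f : A → B) (xs ys : List A) → map f xs ↭ map f ys →
        ∃[ ls ] (map proj₁ ls ≡ xs × map proj₂ ls ↭ ys × All (λ (x , y) → f x ≡ f y) ls)
match f xs ys eq with ↭-map-inv f (↭-sym eq)
... | zs , fxs≡fzs , ys↭zs with pair-up f xs zs fxs≡fzs
... | ls , left , right , fs = ls , left , ↭-trans (↭-reflexive right) (↭-sym ys↭zs) , fs

-- Splitting a list into the fibres of a colouring

module _ {n : ℕ} (f : A → Fin n) where

  fibre : Fin n → List A → List A
  fibre i = filter (λ x → f x ≟ i)

  ∉⇒fibre-empty : ∀ {i} xs → i ∉ map f xs → fibre i xs ≡ []
  ∉⇒fibre-empty {i} xs i∉ = filter-none _ (All.tabulate λ x∈ fx≡i → i∉ (subst (_∈ map f xs) fx≡i (∈-map⁺ f x∈)))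

  length-fibre : ∀ {i} xs → Unique (map f xs) → i ∈ map f xs → length (fibre i xs) ≡ 1
  length-fibre {i} (x ∷ xs) (fx∉ ∷ u) i∈ with f x ≟ i
  ... | yes refl = cong (suc ∘ length) (∉⇒fibre-empty xs λ fx∈ → All.lookup fx∉ fx∈ refl)
  ... | no fx≢i with i∈
  ...   | here i≡fx = ⊥-elim (fx≢i (sym i≡fx))
  ...   | there i∈  = length-fibre xs u i∈

  fibres-of : List (Fin n) → List A → List A
  fibres-of is xs = concatMap (λ i → fibre i xs) is

  fibres-∷-∉ : ∀ {is} x xs → f x ∉ is → fibres-of is (x ∷ xs) ≡ fibres-of is xs
  fibres-∷-∉ {[]}     x xs _  = refl
  fibres-∷-∉ {i ∷ is} x xs fx∉ = cong₂ _++_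
    (filter-reject (λ y → f y ≟ i) (fx∉ ∘ here)) (fibres-∷-∉ x xs (fx∉ ∘ there))

  -- Since `is` lists the colour of `x` exactly once, `x` enters exactly one fibre.
  fibres-∷-∈ : ∀ {is} x xs → Unique is → f x ∈ is → fibres-of is (x ∷ xs) ↭ x ∷ fibres-of is xs
  fibres-∷-∈ {i ∷ is} x xs (i∉ ∷ u) fx∈ with f x ≟ i | fx∈
  ... | yes refl | _         = prep x (↭-reflexive (cong (fibre i xs ++_)
                                 (fibres-∷-∉ x xs λ fx∈is → All.lookup i∉ fx∈is refl)))
  ... | no fx≢i  | here fx≡i = ⊥-elim (fx≢i fx≡i)
  ... | no _     | there fx∈is =
    ↭-trans (++⁺ˡ (fibre i xs) (fibres-∷-∈ x xs u fx∈is)) (shift x (fibre i xs) _)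

  fibres-↭ : ∀ xs → fibres-of (allFin n) xs ↭ xs
  fibres-↭ []       = ↭-reflexive (empty (allFin n))
    where
    empty : ∀ is → fibres-of is [] ≡ []
    empty []       = refl
    empty (_ ∷ is) = empty is
  fibres-↭ (x ∷ xs) =
    ↭-trans (fibres-∷-∈ x xs (Unique.allFin⁺ n) (∈-allFin (f x))) (prep x (fibres-↭ xs))

-- Initial homomorphisms preserve reachability

module _ {N₁ N₂ : Net ℓ} (h : NodeMap N₁ N₂) (hom : IsHomomorphism h) (init : IsInitial h) where
  private
    module N₁ = Net N₁
    module N₂ = Net N₂

  reachable-map : ∀ {M} → N₁.Reachable M → N₂.Reachable (map (place h) M)
  reachable-map (N₁.initially M↭In) = N₂.initially (↭-trans (map⁺ _ M↭In) init)
  reachable-map (N₁.fire {t = t} r (R , before , after)) =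
    N₂.fire (reachable-map r) (map (place h) R
      , ↭-trans (++⁺ʳ _ (↭-sym (proj₁ (hom t)))) (↭-trans (↭-reflexive (sym (map-++ _ (pre N₁ t) R))) (map⁺ _ before))
      , ↭-trans (map⁺ _ after) (↭-trans (↭-reflexive (map-++ _ (post N₁ t) R)) (++⁺ʳ _ (proj₂ (hom t)))))

  marked-map : ∀ {x} → ReachablePart.Marked N₁ x → ReachablePart.Marked N₂ (place h x)
  marked-map (M , r , x∈) = map (place h) M , reachable-map r , ∈-map⁺ (place h) x∈

  enabled-map : ∀ {t} → ReachablePart.EnabledSomewhere N₁ t →
                ReachablePart.EnabledSomewhere N₂ (transn h t)
  enabled-map {t} (M , r , pre⊑M) =
    map (place h) M , reachable-map r , ⊑-respˡ (proj₁ (hom t)) (⊑-map (place h) pre⊑M)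

-- Every node of an occurrence net is reachable

module OccurrenceNetReachability (em : ExcludedMiddle ℓ) (N : Net ℓ) (occ : Net.IsOccurrenceNet N) where
  open Net N hiding (Place; Trans; pre; post; In)
  open IsOccurrenceNet occ
  open ReachablePart N using (Marked; EnabledSomewhere; post-marked)

  data Origin (x : Place N) : Set ℓ where
    initial  : x ∈ In N → Origin x
    produced : ∀ {t} → x ∈ post N t → Origin x

  origin : ∀ x → Origin x
  origin x with em {∃[ t ] x ∈ post N t}
  ... | yes (t , x∈) = produced x∈
  ... | no ∄t        = initial (Equivalence.from (In-minimal x) λ t x∈ → ∄t (t , x∈))

  -- Causes of t₀ that can be fired one after the other. As t₀ is not in
  -- conflict with itself, no two of them compete for a place.
  record History (t₀ : Trans N) : Set ℓ where
    field
      fired     : List (Trans N)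
      marking   : Marking
      reachable : Reachable marking
      balance   : marking ++ concatMap (pre N) fired ↭ In N ++ concatMap (post N) fired
      causes    : All (λ t → inj₂ t ⟶* inj₂ t₀) fired
      enabled   : All EnabledSomewhere fired

  open History

  -- The place has been marked at some time, though it may have been consumed since. Unlike being
  -- marked now, this persists when the history grows.
  Available : ∀ {t₀} → History t₀ → Place N → Set ℓ
  Available H x = x ∈ In N ++ concatMap (post N) (fired H)

  infix 4 _≼_

  _≼_ : ∀ {t₀} → History t₀ → History t₀ → Set ℓ
  H ≼ H′ = ∀ {t} → t ∈ fired H → t ∈ fired H′

  available-produced : ∀ {t₀ x t} (H : History t₀) → t ∈ fired H → x ∈ post N t → Available H x
  available-produced H t∈ x∈ = ∈-++⁺ʳ (In N) (∈-concatMap⁺ (post N) (Any.map (λ { refl → x∈ }) t∈))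

  available-≼ : ∀ {t₀ x} (H H′ : History t₀) → H ≼ H′ → Available H x → Available H′ x
  available-≼ H H′ H≼H′ x∈ with ∈-++⁻ (In N) x∈
  ... | inj₁ x∈In = ∈-++⁺ˡ x∈In
  ... | inj₂ x∈post with find (∈-concatMap⁻ (post N) x∈post)
  ... | t , t∈ , x∈t = available-produced H′ (H≼H′ t∈) x∈t

  empty : ∀ {t₀} → History t₀
  empty = record
    { fired = [] ; marking = In N ; reachable = initially ↭-refl
    ; balance = ↭-refl ; causes = [] ; enabled = [] }

  -- By `balance`, an available place is still marked or was consumed by a fired transition. In the
  -- second case `t` and that transition, both causes of `t₀`, would compete for the place, a
  -- conflict of `t₀` with itself.
  fire-next : ∀ {t₀ t} (H : History t₀) → inj₂ t ⟶* inj₂ t₀ →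
              (∀ {x} → x ∈ pre N t → Available H x) → ∃[ H′ ] (H ≼ H′ × t ∈ fired H′)
  fire-next {t₀} {t} H t⟶*t₀ available with em {t ∈ fired H}
  -- A transition fires at most once; this makes every fired competitor distinct from `t` in the
  -- other case.
  ... | yes t∈ = H , id , t∈
  ... | no t∉  = H′ , there , here refl
    where
    unconsumed : ∀ {ts x} → All (λ u → inj₂ u ⟶* inj₂ t₀) ts → t ∉ ts →
                 x ∈ pre N t → x ∉ concatMap (pre N) ts
    unconsumed {u ∷ us} {x} (u⟶*t₀ ∷ us⟶*t₀) t∉us x∈t x∈ with ∈-++⁻ (pre N u) x∈
    ... | inj₁ x∈u  = no-self-conflict t₀
      (x , (λ ()) , (λ ()) , t , u , x∈t , x∈u , (t∉us ∘ here) , t⟶*t₀ , u⟶*t₀)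
    ... | inj₂ x∈us = unconsumed us⟶*t₀ (t∉us ∘ there) x∈t x∈us

    present : ∀ {x} → x ∈ pre N t → x ∈ marking H
    present x∈ = [ id , (λ x∈′ → ⊥-elim (unconsumed (causes H) t∉ x∈ x∈′)) ]′
      (∈-++⁻ (marking H) (∈-resp-↭ (↭-sym (balance H)) (available x∈)))

    pre⊑ : pre N t ⊑ marking H
    pre⊑ = unique-⊆⇒⊑ (pre-set t) present

    rest : Marking
    rest = proj₁ pre⊑

    balance′ : (post N t ++ rest) ++ pre N t ++ concatMap (pre N) (fired H)
               ↭ In N ++ post N t ++ concatMap (post N) (fired H)
    balance′ = begin
      (post N t ++ rest) ++ pre N t ++ pres      ≡⟨ ++-assoc (post N t) rest _ ⟩
      post N t ++ rest ++ pre N t ++ pres        ↭⟨ ++⁺ˡ (post N t) (shifts rest (pre N t)) ⟩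
      post N t ++ pre N t ++ rest ++ pres        ≡⟨ cong (post N t ++_) (++-assoc (pre N t) rest pres) ⟨
      post N t ++ (pre N t ++ rest) ++ pres      ↭⟨ ++⁺ˡ (post N t) (++⁺ʳ pres (proj₂ pre⊑)) ⟩
      post N t ++ marking H ++ pres              ↭⟨ ++⁺ˡ (post N t) (balance H) ⟩
      post N t ++ In N ++ posts                  ↭⟨ shifts (post N t) (In N) ⟩
      In N ++ post N t ++ posts                  ∎
      where
      open PermutationReasoning
      pres  = concatMap (pre N) (fired H)
      posts = concatMap (post N) (fired H)

    H′ : History t₀
    H′ = record
      { fired     = t ∷ fired H
      ; marking   = post N t ++ rest
      ; reachable = fire (reachable H) (rest , proj₂ pre⊑ , ↭-refl)
      ; balance   = balance′
      ; causes    = t⟶*t₀ ∷ causes H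
      ; enabled   = (marking H , reachable H , pre⊑) ∷ enabled H
      }

  -- Well-founded recursion backwards along the flow: the producers of the places in `pre N t` fire
  -- first, and each of them is a cause of `t₀` through `t`.
  extend : ∀ {t₀ t} → Acc _⟶_ (inj₂ t) → inj₂ t ⟶* inj₂ t₀ →
           (H : History t₀) → ∃[ H′ ] (H ≼ H′ × t ∈ fired H′)
  extend {t₀} {t} (acc rs) t⟶*t₀ H =
    let H₁ , H≼H₁ , available = gather (pre N t) id H
        H₂ , H₁≼H₂ , t∈       = fire-next H₁ t⟶*t₀ available
    in H₂ , (λ u∈ → H₁≼H₂ (H≼H₁ u∈)) , t∈
    where
    provide : ∀ {x} → x ∈ pre N t → (H : History t₀) → ∃[ H′ ] (H ≼ H′ × Available H′ x)
    provide {x} x∈ H with origin x | rs (into x∈)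
    ... | initial x∈In        | _       = H , id , ∈-++⁺ˡ x∈In
    ... | produced {u} x∈post | acc rs′ =
      let H′ , H≼H′ , u∈ = extend (rs′ (outof x∈post)) (outof x∈post ◅ into x∈ ◅ t⟶*t₀) H
      in H′ , H≼H′ , available-produced H′ u∈ x∈post

    gather : ∀ xs → (∀ {x} → x ∈ xs → x ∈ pre N t) → (H : History t₀) →
             ∃[ H′ ] (H ≼ H′ × (∀ {x} → x ∈ xs → Available H′ x))
    gather []       _   H = H , id , λ ()
    gather (x ∷ xs) xs⊆ H =
      let H₁ , H≼H₁  , x-available  = provide (xs⊆ (here refl)) H
          H₂ , H₁≼H₂ , xs-available = gather xs (xs⊆ ∘ there) H₁
      in H₂ , (λ u∈ → H₁≼H₂ (H≼H₁ u∈)) ,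
         λ { (here refl) → available-≼ H₁ H₂ H₁≼H₂ x-available ; (there y∈) → xs-available y∈ }

  all-enabled : ∀ t → EnabledSomewhere t
  all-enabled t = let H , _ , t∈ = extend (wellFounded (inj₂ t)) ε empty in All.lookup (enabled H) t∈

  all-marked : ∀ x → Marked x
  all-marked x with origin x
  ... | initial x∈      = In N , initially ↭-refl , x∈
  ... | produced {t} x∈ = post-marked (all-enabled t) x∈

-- Enabled transitions preserve the multiset of owners

module _ (G : PetriGame ℓ) where
  open PetriGame G using (net; owner; onEnvironment?)

  environmentTokens : List (Place net) → ℕ
  environmentTokens M = length (filter onEnvironment? M)

  -- With only two owners, the size and the number of environment tokens determine the multiset;
  -- moving `environment` to the front is a normal form.
  owners-↭-replicate : ∀ xs → map owner xs ↭
    replicate (environmentTokens xs) environment ++ replicate (length xs ∸ environmentTokens xs) system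
  owners-↭-replicate [] = ↭-refl
  owners-↭-replicate (x ∷ xs) with owner x | owners-↭-replicate xs
  ... | environment | ih = prep environment ih
  -- The truncated subtraction commutes with the successor because filtering does not lengthen `xs`.
  ... | system      | ih
    rewrite +-∸-assoc 1 (length-filter onEnvironment? xs) =
      ↭-trans (prep system ih) (↭-sym (shift system (replicate (environmentTokens xs) environment) _))

  owners-↭ : ∀ xs ys → length xs ≡ length ys → environmentTokens xs ≡ environmentTokens ys →
             map owner xs ↭ map owner ys
  owners-↭ xs ys lengths tokens = begin
    map owner xs                                   ↭⟨ owners-↭-replicate xs ⟩
    normalForm (environmentTokens xs) (length xs)  ≡⟨ cong₂ normalForm tokens lengths ⟩
    normalForm (environmentTokens ys) (length ys)  ↭⟨ owners-↭-replicate ys ⟨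
    map owner ys                                   ∎
    where
    open PermutationReasoning
    normalForm : ℕ → ℕ → List Owner
    normalForm e n = replicate e environment ++ replicate (n ∸ e) system

  environmentTokens-++ : ∀ xs ys → environmentTokens (xs ++ ys) ≡ environmentTokens xs + environmentTokens ys
  environmentTokens-++ xs ys =
    trans (cong length (filter-++ onEnvironment? xs ys)) (length-++ (filter onEnvironment? xs))

  environmentTokens-↭ : ∀ {xs ys} → xs ↭ ys → environmentTokens xs ≡ environmentTokens ys
  environmentTokens-↭ eq = ↭-length (filter-↭ onEnvironment? eq)

  -- The markings before and after firing `t` share the rest `R` and have one environment token
  -- each. Cancelling `R` leaves equally many such tokens in the preset and the postset, whose sizes
  -- agree by concurrency preservation.
  owners-preserved : PetriGame.OneEnvironmentPlayer G → Net.ConcurrencyPreserving net →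
    ∀ {t} → ReachablePart.EnabledSomewhere net t → map owner (pre net t) ↭ map owner (post net t)
  owners-preserved one cp {t} (M , r , R , pre⊑M) = owners-↭ _ _ (cp t)
    (+-cancelʳ-≡ (environmentTokens R) _ _
      (trans (sym (environmentTokens-++ (pre net t) R))
        (trans (trans (environmentTokens-↭ pre⊑M) (one r))
          (trans (sym (one (Net.fire r (R , pre⊑M , ↭-refl))))
            (environmentTokens-++ (post net t) R)))))

-- The colour of a place is the initial place it descends from

module Descent
  (em : ExcludedMiddle ℓ) (N : Net ℓ) (occ : Net.IsOccurrenceNet N)
  {n : ℕ} (origins : Fin n → Place N) (origins-injective : ∀ {i j} → origins i ≡ origins j → i ≡ j)
  (In↭origins : In N ↭ tabulate origins)
  (links : Trans N → List (Place N × Place N))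
  (links-pre  : ∀ t → map proj₁ (links t) ≡ pre N t)
  (links-post : ∀ t → map proj₂ (links t) ↭ post N t)
  where
  open Net N using (_⟶_; into; outof; IsOccurrenceNet)
  open IsOccurrenceNet occ
  open OccurrenceNetReachability em N occ using (Origin; initial; produced; origin)

  -- A link says which consumed token becomes which produced token, so a derivation is the past of
  -- one player back to its initial place.
  data Descends (x : Place N) (i : Fin n) : Set ℓ where
    root : x ≡ origins i → Descends x i
    via   : ∀ t {y} → (y , x) ∈ links t → Descends y i → Descends x i

  link-pre : ∀ {t x y} → (x , y) ∈ links t → x ∈ pre N t
  link-pre {t} l∈ = subst (_ ∈_) (links-pre t) (∈-map⁺ proj₁ l∈)

  link-post : ∀ {t x y} → (x , y) ∈ links t → y ∈ post N t
  link-post {t} l∈ = ∈-resp-↭ (links-post t) (∈-map⁺ proj₂ l∈)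

  origins-initial : ∀ i → origins i ∈ In N
  origins-initial i = ∈-resp-↭ (↭-sym In↭origins) (∈-tabulate⁺ i)

  descends : ∀ {x} → Acc _⟶_ (inj₁ x) → ∃[ i ] Descends x i
  descends {x} (acc rs) with origin x
  ... | initial x∈ = let i , x≡ = ∈-tabulate⁻ (∈-resp-↭ In↭origins x∈) in i , root x≡
  ... | produced {t} x∈ with ∈-map⁻ proj₂ (∈-resp-↭ (↭-sym (links-post t)) x∈) | rs (outof x∈)
  ... | (y , _) , l∈ , refl | acc rs′ =
    let i , d = descends (rs′ (into (link-pre l∈))) in i , via t l∈ d

  linked-uniquely : ∀ {A B : Set ℓ} {ls : List (A × B)} {x y z} → Unique (map proj₂ ls) →
                    (x , z) ∈ ls → (y , z) ∈ ls → x ≡ y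
  linked-uniquely _        (here refl) (here refl) = refl
  linked-uniquely (z∉ ∷ _) (here refl) (there y∈)  = ⊥-elim (All.lookup z∉ (∈-map⁺ proj₂ y∈) refl)
  linked-uniquely (z∉ ∷ _) (there x∈)  (here refl) = ⊥-elim (All.lookup z∉ (∈-map⁺ proj₂ x∈) refl)
  linked-uniquely (_ ∷ u)  (there x∈)  (there y∈)  = linked-uniquely u x∈ y∈

  initial-not-linked : ∀ {t x y} → y ∈ In N → (x , y) ∉ links t
  initial-not-linked {t} {y = y} y∈ l∈ = Equivalence.to (In-minimal y) y∈ t (link-post l∈)

  -- The backward walk is deterministic: a place has at most one producer, occurs once in its
  -- postset and hence in one link, and an initial place has no producer at which to continue.
  descends-unique : ∀ {x i j} → Descends x i → Descends x j → i ≡ j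
  descends-unique (root refl) (root eq)     = origins-injective eq
  descends-unique (root refl) (via t l∈ _)  = ⊥-elim (initial-not-linked (origins-initial _) l∈)
  descends-unique (via t l∈ _) (root refl)  = ⊥-elim (initial-not-linked (origins-initial _) l∈)
  descends-unique (via t l∈ d) (via u l′∈ e) with one-producer (link-post l∈) (link-post l′∈)
  ... | refl with linked-uniquely (↭-unique (↭-sym (links-post t)) (post-set t)) l∈ l′∈
  ... | refl = descends-unique d e

  colour : Place N → Fin n
  colour x = proj₁ (descends (wellFounded (inj₁ x)))

  colour-descends : ∀ x → Descends x (colour x)
  colour-descends x = proj₂ (descends (wellFounded (inj₁ x)))

  colour-In : map colour (In N) ↭ allFin n
  colour-In = begin
    map colour (In N)              ↭⟨ map⁺ colour In↭origins ⟩
    map colour (tabulate origins)  ≡⟨ map-tabulate origins colour ⟩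
    tabulate (colour ∘ origins)    ≡⟨ tabulate-cong (λ i → descends-unique (colour-descends (origins i)) (root refl)) ⟩
    allFin n                       ∎
    where open PermutationReasoning

  -- Linked places descend from the same origin, so the colours agree link by link.
  colour-flow : ∀ t → map colour (pre N t) ↭ map colour (post N t)
  colour-flow t = begin
    map colour (pre N t)                ≡⟨ cong (map colour) (links-pre t) ⟨
    map colour (map proj₁ (links t))    ≡⟨ map-∘ (links t) ⟨
    map (colour ∘ proj₁) (links t)      ≡⟨ map-cong-local (All.tabulate λ l∈ →
      descends-unique (via t l∈ (colour-descends _)) (colour-descends _)) ⟩
    map (colour ∘ proj₂) (links t)      ≡⟨ map-∘ (links t) ⟩
    map colour (map proj₂ (links t))    ↭⟨ map⁺ colour (links-post t) ⟩
    map colour (post N t)               ∎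
    where open PermutationReasoning

  -- Applied to owners, this shows that each colour belongs entirely to the environment or entirely
  -- to the system.
  invariant : (f : Place N → A) → (∀ t → All (λ (x , y) → f x ≡ f y) (links t)) →
              ∀ {x i} → Descends x i → f x ≡ f (origins i)
  invariant f linked (root refl)  = refl
  invariant f linked (via t l∈ d) = trans (sym (All.lookup (linked t) l∈)) (invariant f linked d)

-- A colouring of the places such that every reachable marking has exactly one
-- place of each colour splits an occurrence net into single-token threads

module Threads
  {N : Net ℓ} (L : LabelledNet N) (hom : IsHomomorphism (LabelledNet.label L))
  (occ : Net.IsOccurrenceNet (LabelledNet.net L))
  (enabled : ∀ t → ReachablePart.EnabledSomewhere (LabelledNet.net L) t)
  (marked : ∀ x → ReachablePart.Marked (LabelledNet.net L) x)
  {n : ℕ} (colour : Place (LabelledNet.net L) → Fin n)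
  (colour-In : map colour (In (LabelledNet.net L)) ↭ allFin n)
  (colour-flow : ∀ t → map colour (pre (LabelledNet.net L) t) ↭ map colour (post (LabelledNet.net L) t))
  where
  open DecMembership (_≟_ {n}) using (_∈?_)
  open LabelledNet L using (label) renaming (net to S)
  open Net.IsOccurrenceNet occ
  open Net S using (Reachable; initially; fire)

  reachable-colours : ∀ {M} → Reachable M → map colour M ↭ allFin n
  reachable-colours (initially M↭In) = ↭-trans (map⁺ colour M↭In) colour-In
  reachable-colours (fire {M} {t} {M′} r (R , before , after)) = begin
    map colour M′                            ↭⟨ map⁺ colour after ⟩
    map colour (post S t ++ R)               ≡⟨ map-++ colour (post S t) R ⟩
    map colour (post S t) ++ map colour R    ↭⟨ ++⁺ʳ (map colour R) (colour-flow t) ⟨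
    map colour (pre S t) ++ map colour R     ≡⟨ map-++ colour (pre S t) R ⟨
    map colour (pre S t ++ R)                ↭⟨ map⁺ colour before ⟩
    map colour M                             ↭⟨ reachable-colours r ⟩
    allFin n                                 ∎
    where open PermutationReasoning

  -- The preset lies in some reachable marking, where all colours are distinct. Hence a transition
  -- takes at most one token from each thread.
  pre-colours-unique : ∀ t → Unique (map colour (pre S t))
  pre-colours-unique t = let M , r , pre⊑M = enabled t in
    ⊑-unique (⊑-map colour pre⊑M) (↭-unique (↭-sym (reachable-colours r)) (Unique.allFin⁺ n))

  -- Testing the preset also covers the postset, by `colour-flow`.
  Meets : Trans S → Fin n → Set
  Meets t i = i ∈ map colour (pre S t)

  -- The thread of one colour as an unfolded local controller

  module Thread (i : Fin n) where

    -- The proof of `Meets` is irrelevant so that the underlying transition determines the thread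
    -- transition; for places, proofs of an equation between colours are unique anyway.
    ThreadPlace ThreadTrans : Set ℓ
    ThreadPlace = Σ (Place S) λ x → colour x ≡ i
    ThreadTrans = Refinement (Trans S) λ t → Meets t i

    place-injective : {x y : ThreadPlace} → proj₁ x ≡ proj₁ y → x ≡ y
    place-injective {_ , refl} {_ , refl} refl = refl

    trans-injective : {t u : ThreadTrans} → value t ≡ value u → t ≡ u
    trans-injective refl = refl

    meets : (t : ThreadTrans) → Meets (value t) i
    -- Deciding membership recovers a usable proof from the irrelevant one.
    meets (t , [ m ]) = recompute (i ∈? map colour (pre S t)) m

    select : List (Place S) → List ThreadPlace
    select []       = []
    select (x ∷ xs) with colour x ≟ i
    ... | yes eq = (x , eq) ∷ select xs
    ... | no _   = select xs

    map-select : ∀ xs → map proj₁ (select xs) ≡ fibre colour i xs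
    map-select []       = refl
    map-select (x ∷ xs) with colour x ≟ i
    ... | yes _ = cong (x ∷_) (map-select xs)
    ... | no _  = map-select xs

    ∈-select⁺ : ∀ {xs} (x : ThreadPlace) → proj₁ x ∈ xs → x ∈ select xs
    ∈-select⁺ {xs} (x , cx≡i) x∈
      with ∈-map⁻ proj₁ (subst (x ∈_) (sym (map-select xs)) (∈-filter⁺ (λ y → colour y ≟ i) x∈ cx≡i))
    ... | y , y∈ , x≡y = subst (_∈ select xs) (place-injective (sym x≡y)) y∈

    ∈-select⁻ : ∀ {xs x} → x ∈ select xs → proj₁ x ∈ xs
    ∈-select⁻ {xs} x∈ = proj₁ (∈-filter⁻ (λ y → colour y ≟ i) (subst (_ ∈_) (map-select xs) (∈-map⁺ proj₁ x∈)))

    length-select : ∀ xs → Unique (map colour xs) → i ∈ map colour xs → length (select xs) ≡ 1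
    length-select xs u i∈ = trans (sym (length-map proj₁ (select xs)))
      (trans (cong length (map-select xs)) (length-fibre colour xs u i∈))

    length-pre : ∀ t → length (select (pre S (value t))) ≡ 1
    length-pre t = length-select _ (pre-colours-unique (value t)) (meets t)

    length-post : ∀ t → length (select (post S (value t))) ≡ 1
    length-post t = length-select _ (↭-unique (colour-flow (value t)) (pre-colours-unique (value t)))
      (∈-resp-↭ (colour-flow (value t)) (meets t))

    length-In : length (select (In S)) ≡ 1
    length-In = length-select _ (↭-unique (↭-sym colour-In) (Unique.allFin⁺ n))
      (∈-resp-↭ (↭-sym colour-In) (∈-allFin i))

    thread : Net ℓ
    thread = record
      { Place         = ThreadPlace
      ; Trans         = ThreadTrans
      ; pre           = λ t → select (pre S (value t))
      ; post          = λ t → select (post S (value t))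
      ; pre-nonempty  = λ t → singleton-nonempty (length-pre t)
      ; post-nonempty = λ t → singleton-nonempty (length-post t)
      ; In            = select (In S)
      }

    private
      module T = Net thread

    embed : NodeMap thread S
    embed = record { place = proj₁ ; transn = value }

    node : T.Node → Net.Node S
    node = Sum.map proj₁ value

    embed-arc : ∀ {x y} → x T.⟶ y → Net._⟶_ S (node x) (node y)
    embed-arc (T.into x∈)  = Net.into (∈-select⁻ x∈)
    embed-arc (T.outof x∈) = Net.outof (∈-select⁻ x∈)

    -- Arcs of the thread are arcs of `S`, so well-foundedness and freedom from self-conflict pull
    -- back along `embed`; presets, postsets and `In` are singletons.
    occurrenceNet : T.IsOccurrenceNet
    occurrenceNet = record
      { pre-set          = λ t → singleton-unique (length-pre t)
      ; post-set         = λ t → singleton-unique (length-post t)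
      ; one-producer     = λ x∈t x∈u → trans-injective (one-producer (∈-select⁻ x∈t) (∈-select⁻ x∈u))
      ; wellFounded      = Subrelation.wellFounded embed-arc (On.wellFounded node wellFounded)
      ; no-self-conflict = λ { t (x , _ , _ , u , v , x∈u , x∈v , u≢v , u⟶*t , v⟶*t) →
          no-self-conflict (value t)
            (proj₁ x , (λ ()) , (λ ()) , value u , value v , ∈-select⁻ x∈u , ∈-select⁻ x∈v ,
             u≢v ∘ trans-injective , gmap node embed-arc u⟶*t , gmap node embed-arc v⟶*t) }
      ; In-set           = singleton-unique length-In
      ; In-minimal       = λ x → mk⇔
          (λ x∈In t x∈ → Equivalence.to (In-minimal (proj₁ x)) (∈-select⁻ x∈In) (value t) (∈-select⁻ x∈))
          (λ unproduced → ∈-select⁺ x (Equivalence.from (In-minimal (proj₁ x)) λ t x∈ →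
            unproduced (t , [ producer-meets x x∈ ]) (∈-select⁺ x x∈)))
      }
      where
      -- A producer of a place of colour `i` also consumes one, so it belongs to the thread. Thus a
      -- place without producer in the thread has none in `S` either.
      producer-meets : ∀ (x : ThreadPlace) {t} → proj₁ x ∈ post S t → Meets t i
      producer-meets (x , refl) {t} x∈ = ∈-resp-↭ (↭-sym (colour-flow t)) (∈-map⁺ colour x∈)

    single-token-invariant : ∀ {M} → T.Reachable M → length M ≡ 1
    single-token-invariant (T.initially M↭In) = trans (↭-length M↭In) length-In
    single-token-invariant (T.fire {t = t} r (R , before , after)) =
      trans (↭-length after) (trans (length-++ (T.post t))
        (trans (cong (_+ length R) (trans (length-post t) (sym (length-pre t))))
          (trans (sym (length-++ (T.pre t))) (trans (↭-length before) (single-token-invariant r)))))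

    labelThread : NodeMap thread N
    labelThread = label ⊚ embed

    -- The places of the other colours fill up the difference; their absence from the thread is why
    -- the map is only a weak homomorphism.
    label-select : ∀ xs {ys} → map (place label) xs ↭ ys → map (place labelThread) (select xs) ⊑ ys
    label-select xs eq = ⊑-respʳ eq (⊑-respˡ
      (↭-reflexive (sym (trans (map-∘ (select xs)) (cong (map (place label)) (map-select xs)))))
      (⊑-map (place label) (_ , ↭-sym (filter-∁-↭ (λ x → colour x ≟ i) xs))))

    controller : LocalController N
    controller = record
      { net               = thread
      ; map-to            = labelThread
      ; safe              = λ r → singleton-unique (single-token-invariant r)
      ; single-token      = length-In
      ; single-pre        = length-pre
      ; single-post       = length-post
      ; weak-homomorphism = λ t → label-select (pre S (value t)) (proj₁ (hom (value t)))
                                  , label-select (post S (value t)) (proj₂ (hom (value t)))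
      }

    selfUnfolding : BranchingProcess thread
    selfUnfolding = record
      { net           = thread
      ; label         = record { place = id ; transn = id }
      ; occurrenceNet = occurrenceNet
      ; homomorphism  = λ t → ↭-reflexive (map-id _) , ↭-reflexive (map-id _)
      ; no-duplicates = λ _ t≡u → t≡u
      }

    -- Under the identity labelling, a set of places with image the preset of `t` is that preset, so
    -- `t` itself is the required transition.
    isUnfolding : IsUnfolding selfUnfolding
    isUnfolding = record
      { initial  = ↭-reflexive (map-id _)
      ; complete = λ t C _ _ eq → t , ↭-trans (↭-sym eq) (↭-reflexive (map-id C)) , refl
      }

  -- The family components E S only reduces at zero and suc i, so a thread is
  -- characterised here by properties that can be proved for either case.
  record IsThread (i : Fin n) (C : LabelledNet N) : Set ℓ where
    private
      module C = LabelledNet C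
    field
      embed           : NodeMap C.net S
      place-injective : ∀ {x y} → place embed x ≡ place embed y → x ≡ y
      trans-injective : ∀ {t u} → transn embed t ≡ transn embed u → t ≡ u
      place-colour    : ∀ x → colour (place embed x) ≡ i
      place-onto      : ∀ x → colour x ≡ i → ∃[ y ] place embed y ≡ x
      trans-meets     : ∀ t → Meets (transn embed t) i
      trans-onto      : ∀ t → Meets t i → ∃[ u ] transn embed u ≡ t
      pre-fibre       : ∀ t → map (place embed) (pre C.net t) ≡ fibre colour i (pre S (transn embed t))
      post-fibre      : ∀ t → map (place embed) (post C.net t) ≡ fibre colour i (post S (transn embed t))
      In-fibre        : map (place embed) (In C.net) ≡ fibre colour i (In S)
      place-label     : ∀ x → place C.label x ≡ place label (place embed x)
      trans-label     : ∀ t → transn C.label t ≡ transn label (transn embed t)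

  thread-isThread : ∀ i →
    IsThread i (record { net = Thread.thread i ; label = Thread.labelThread i })
  thread-isThread i = record
    { embed           = embed
    ; place-injective = place-injective
    ; trans-injective = trans-injective
    ; place-colour    = proj₂
    ; place-onto      = λ x cx≡i → (x , cx≡i) , refl
    ; trans-meets     = meets
    ; trans-onto      = λ t m → (t , [ m ]) , refl
    ; pre-fibre       = λ t → map-select (pre S (value t))
    ; post-fibre      = λ t → map-select (post S (value t))
    ; In-fibre        = map-select (In S)
    ; place-label     = λ _ → refl
    ; trans-label     = λ _ → refl
    }
    where open Thread i

  -- Composing the threads gives back the net

  module Recomposition (C : Fin n → LabelledNet N) (isThread : ∀ i → IsThread i (C i)) where
    private
      module C i = LabelledNet (C i)
      module I i = IsThread (isThread i)

    -- Thread transitions are named by their images in `S`, so threads synchronise exactly on the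
    -- transitions of `S` that they share.
    threadUnion : TransitionUnion C
    threadUnion = record
      { T              = Trans S
      ; name           = λ i → transn (I.embed i)
      ; name-injective = λ i → I.trans-injective i
      ; name?          = name?
      -- Any input place of `t` will do: the thread of its colour contains `t`.
      ; covered        = λ t → let x , x∈ = nonempty-∈ (Net.pre-nonempty S t)
                                   i      = colour x
                               in i , I.trans-onto i t (∈-map⁺ colour x∈)
      ; labels-agree   = λ i j {t} {u} eq →
          trans (I.trans-label i t) (trans (cong (transn label) eq) (sym (I.trans-label j u)))
      }
      where
      name? : ∀ i t → Dec (∃[ u ] transn (I.embed i) u ≡ t)
      name? i t with i ∈? map colour (pre S t)
      ... | yes m = yes (I.trans-onto i t m)
      ... | no ¬m = no λ { (u , refl) → ¬m (I.trans-meets i u) }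

    open Parallel C threadUnion using (Places; contribution; unite; composition) renaming (net to ∥C)
    open TransitionUnion threadUnion using (name?; covered)
    open ReachablePart ∥C using (reachableNet; restrict; Marked; EnabledSomewhere)

    back : NodeMap ∥C S
    back = record { place = λ (i , x) → place (I.embed i) x ; transn = id }

    -- The tag of a place in the composition is recovered as the colour of its image.
    back-injective : ∀ {x y} → place back x ≡ place back y → x ≡ y
    back-injective {i , x} {j , y} eq
      with trans (sym (I.place-colour i x)) (trans (cong colour eq) (I.place-colour j y))
    ... | refl = cong (i ,_) (I.place-injective i eq)

    forth : NodeMap S ∥C
    forth = record { place = λ x → colour x , proj₁ (I.place-onto (colour x) x refl) ; transn = id }

    back-forth : ∀ x → place back (place forth x) ≡ x
    back-forth x = proj₂ (I.place-onto (colour x) x refl)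

    back⇒forth : ∀ xs {ys} → map (place back) xs ↭ ys → map (place forth) ys ↭ xs
    back⇒forth xs {ys} eq = begin
      map (place forth) ys                     ↭⟨ map⁺ (place forth) eq ⟨
      map (place forth) (map (place back) xs)  ≡⟨ map-∘ xs ⟨
      map (place forth ∘ place back) xs        ≡⟨ map-cong (λ x → back-injective (back-forth (place back x))) xs ⟩
      map id xs                                ≡⟨ map-id xs ⟩
      xs                                       ∎
      where open PermutationReasoning

    module _ (f : ∀ i → Trans (C.net i) → List (Place (C.net i))) (g : Trans S → List (Place S))
             (f-fibre : ∀ i t → map (place (I.embed i)) (f i t) ≡ fibre colour i (g (transn (I.embed i) t)))
             (g-meets : ∀ t {i} → i ∈ map colour (g t) → Meets t i) where

      -- Serves presets and postsets alike. A thread containing `t` contributes the places of its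
      -- colour; if the thread lacks `t`, its colour does not occur in `g t`.
      contribution-back : ∀ t i d → map (place back) (contribution f t i d) ≡ fibre colour i (g t)
      contribution-back t i (yes (u , refl)) = trans (sym (map-∘ (f i u))) (f-fibre i u)
      contribution-back t i (no ∄u) = sym (∉⇒fibre-empty colour (g t) (∄u ∘ I.trans-onto i t ∘ g-meets t))

      unite-back : ∀ t → map (place back) (unite f t) ↭ g t
      unite-back t = begin
        map (place back) (unite f t)
          ≡⟨ map-concatMap (place back) _ (allFin n) ⟩
        concatMap (λ i → map (place back) (contribution f t i (name? i t))) (allFin n)
          ≡⟨ concatMap-cong (λ i → contribution-back t i (name? i t)) (allFin n) ⟩
        concatMap (λ i → fibre colour i (g t)) (allFin n)
          ↭⟨ fibres-↭ colour (g t) ⟩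
        g t ∎
        where open PermutationReasoning

    back-homomorphism : IsHomomorphism back
    back-homomorphism t =
      unite-back (λ i → pre (C.net i)) (pre S) I.pre-fibre (λ _ m → m) t ,
      unite-back (λ i → post (C.net i)) (post S) I.post-fibre (λ t → ∈-resp-↭ (↭-sym (colour-flow t))) t

    back-initial : IsInitial back
    back-initial = begin
      map (place back) (In ∥C)
        ≡⟨ map-concatMap (place back) _ (allFin n) ⟩
      concatMap (λ i → map (place back) (map (i ,_) (In (C.net i)))) (allFin n)
        ≡⟨ concatMap-cong (λ i → trans (sym (map-∘ (In (C.net i)))) (I.In-fibre i)) (allFin n) ⟩
      concatMap (λ i → fibre colour i (In S)) (allFin n)
        ↭⟨ fibres-↭ colour (In S) ⟩
      In S ∎
      where open PermutationReasoning

    -- With `forth`, firing sequences of `S` are replayed in the composition; the resulting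
    -- reachability makes the final isomorphism surjective.
    forth-homomorphism : IsHomomorphism forth
    forth-homomorphism t =
      back⇒forth _ (proj₁ (back-homomorphism t)) , back⇒forth _ (proj₂ (back-homomorphism t))

    forth-initial : IsInitial forth
    forth-initial = back⇒forth _ back-initial

    ∥C-marked : ∀ x → Marked (place forth x)
    ∥C-marked x = marked-map forth forth-homomorphism forth-initial (marked x)

    ∥C-enabled : ∀ t → EnabledSomewhere t
    ∥C-enabled t = enabled-map forth forth-homomorphism forth-initial (enabled t)

    restrict-back : ∀ M .(m : ∀ {x} → x ∈ M → Marked x) {ys} → map (place back) M ↭ ys →
                    map (place back ∘ value) (restrict M m) ↭ ys
    restrict-back M m eq = ↭-trans (↭-reflexive (values M m)) eq
      where
      values : ∀ M .(m : ∀ {x} → x ∈ M → Marked x) →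
               map (place back ∘ value) (restrict M m) ≡ map (place back) M
      values []      _ = refl
      values (x ∷ M) m = cong (place back x ∷_) (values M (m ∘ there))

    recomposed : reachablePart composition ≅ L
    recomposed = record
      { to              = back ⊚ ReachablePart.include ∥C
      ; isIsomorphism   = record
        { homomorphism     = λ { (t , [ e ]) →
            restrict-back _ (ReachablePart.pre-marked ∥C e) (proj₁ (back-homomorphism t)) ,
            restrict-back _ (ReachablePart.post-marked ∥C e) (proj₂ (back-homomorphism t)) }
        ; initial          = restrict-back _ (λ x∈ → _ , Net.initially ↭-refl , x∈) back-initial
        ; place-bijective  = (λ eq → value-injective (back-injective eq))
                           , λ x → (place forth x , [ ∥C-marked x ]) , λ { refl → back-forth x }
        ; transn-bijective = value-injective , λ t → (t , [ ∥C-enabled t ]) , λ { refl → refl }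
        }
      ; place-labelled  = λ { ((i , x) , _) → sym (I.place-label i x) }
      -- Whichever component `covered` picks, its thread labels `t` as `S` does.
      ; transn-labelled = λ { (t , _) → let i , u , u≡t = covered t in
          sym (trans (I.trans-label i u) (cong (transn label) u≡t)) }
      }
      where
      value-injective : ∀ {A : Set ℓ} {P : A → Set ℓ} {x y : Refinement A P} → value x ≡ value y → x ≡ y
      value-injective refl = refl

-- Distributing a strategy over one thread per initial token

lemma4p2 : ∀ {ℓ} → ExcludedMiddle ℓ →
    (G : PetriGame ℓ) → PetriGame.OneEnvironmentPlayer G →
    Net.ConcurrencyPreserving (PetriGame.net G) →
    (β : BranchingProcess (PetriGame.net G)) → IsUnfolding β →
    (σ : Strategy G β) → Distributable G (Strategy.labelledNet σ)
lemma4p2 {ℓ} em G oneEnvironment preserving β _ σ = record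
  { k               = length systemOrigins
  ; envController   = env
  ; sysControllers  = sys
  ; transitionUnion = Recomposition.threadUnion (components env sys) isThread
  ; represents      = Recomposition.recomposed (components env sys) isThread
  }
  where
  open PetriGame G using (owner; onEnvironment?)
  open Strategy σ using (labelledNet; label; homomorphism; initial; occurrenceNet) renaming (net to S)
  open OccurrenceNetReachability em S occurrenceNet using (all-enabled; all-marked)
  open Net.IsOccurrenceNet occurrenceNet using (In-set)

  ownerOf : Place S → Owner
  ownerOf x = owner (place label x)

  -- The labelling sends `In S` to the initial marking of the game, which is reachable and so has
  -- one environment token; filtering commutes with the labelling.
  initialPlaces : ∃[ e ] ∃[ ss ] (In S ↭ e ∷ ss × ownerOf e ≡ environment ×
                                  All (λ x → ¬ ownerOf x ≡ environment) ss)
  initialPlaces = extract-unique (λ x → onEnvironment? (place label x)) (In S)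
    (trans (trans (sym (length-map (place label) (filter (λ x → onEnvironment? (place label x)) (In S))))
                  (cong length (sym (filter-map onEnvironment? (place label) (In S)))))
           (oneEnvironment (Net.initially initial)))

  environmentOrigin : Place S
  environmentOrigin = let e , _ = initialPlaces in e

  systemOrigins : List (Place S)
  systemOrigins = let _ , ss , _ = initialPlaces in ss

  In↭ : In S ↭ environmentOrigin ∷ systemOrigins
  In↭ = let _ , _ , eq , _ = initialPlaces in eq

  environmentOrigin-owned : ownerOf environmentOrigin ≡ environment
  environmentOrigin-owned = let _ , _ , _ , e , _ = initialPlaces in e

  systemOrigins-owned : All (λ x → ¬ ownerOf x ≡ environment) systemOrigins
  systemOrigins-owned = let _ , _ , _ , _ , ss = initialPlaces in ss

  -- The environment origin comes first, so colour `zero` is the environment player and each `suc i`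
  -- a system player, in the order of `components`.
  origins : Fin (suc (length systemOrigins)) → Place S
  origins = lookup (environmentOrigin ∷ systemOrigins)

  -- Every transition of the strategy is enabled somewhere, hence so is its image in the game, where
  -- owners are preserved.
  owners-matched : ∀ t → map ownerOf (pre S t) ↭ map ownerOf (post S t)
  owners-matched t = begin
    map ownerOf (pre S t)                      ≡⟨ map-∘ (pre S t) ⟩
    map owner (map (place label) (pre S t))    ↭⟨ map⁺ owner (proj₁ (homomorphism t)) ⟩
    map owner (pre N (transn label t))         ↭⟨ owners-preserved G oneEnvironment preserving
                                                    (enabled-map label homomorphism initial (all-enabled t)) ⟩
    map owner (post N (transn label t))        ↭⟨ map⁺ owner (proj₂ (homomorphism t)) ⟨
    map owner (map (place label) (post S t))   ≡⟨ map-∘ (post S t) ⟨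
    map ownerOf (post S t)                     ∎
    where
    open PermutationReasoning
    N = PetriGame.net G

  matching : ∀ t → ∃[ ls ] (map proj₁ ls ≡ pre S t × map proj₂ ls ↭ post S t ×
                            All (λ (x , y) → ownerOf x ≡ ownerOf y) ls)
  matching t = match ownerOf (pre S t) (post S t) (owners-matched t)

  links : Trans S → List (Place S × Place S)
  links t = let ls , _ = matching t in ls

  links-pre : ∀ t → map proj₁ (links t) ≡ pre S t
  links-pre t = let _ , left , _ = matching t in left

  links-post : ∀ t → map proj₂ (links t) ↭ post S t
  links-post t = let _ , _ , right , _ = matching t in right

  links-owner : ∀ t → All (λ (x , y) → ownerOf x ≡ ownerOf y) (links t)
  links-owner t = let _ , _ , _ , same = matching t in same

  open Descent em S occurrenceNet origins (lookup-injective (↭-unique In↭ In-set))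
    (↭-trans In↭ (↭-reflexive (sym (tabulate-lookup _))))
    links links-pre links-post

  open Threads labelledNet homomorphism occurrenceNet all-enabled all-marked colour colour-In colour-flow

  colour-owner : ∀ {i} x → colour x ≡ i → ownerOf x ≡ ownerOf (origins i)
  colour-owner x refl = invariant ownerOf links-owner (colour-descends x)

  threadFor : ∀ i {o} → ownerOf (origins i) ≡ o → UnfoldedLocalController G o
  threadFor i owned = record
    { controller  = Thread.controller i
    ; for-owner   = λ (x , cx≡i) → trans (colour-owner x cx≡i) owned
    ; process     = Thread.selfUnfolding i
    ; isUnfolding = Thread.isUnfolding i
    }

  not-environment⇒system : ∀ {o} → ¬ o ≡ environment → o ≡ system
  not-environment⇒system {system}      _ = refl
  not-environment⇒system {environment} ¬e = ⊥-elim (¬e refl)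

  env : UnfoldedLocalController G environment
  env = threadFor zero environmentOrigin-owned

  sys : Fin (length systemOrigins) → UnfoldedLocalController G system
  sys i = threadFor (suc i) (not-environment⇒system
    (All.lookup systemOrigins-owned (∈-lookup i)))

  isThread : ∀ i → IsThread i (components env sys i)
  isThread zero    = thread-isThread zero
  isThread (suc i) = thread-isThread (suc i)
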